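{- Let $G_1,G_2$ be finite abelian groups with $|G_1|+1=|G_2|$. If $\varphi:G_1\to G_2$ is a circular Costas map, then $G_2$ is elementary abelian, i.e. $G_2\cong\mathbb{Z}_p^m$ for some prime $p$ and natural number $m$.
   Context: For finite abelian groups $G_1,G_2$ (written additively) with $|G_1|+1=|G_2|$, a map $\varphi:G_1\to G_2$ is circular Costas if $\varphi$ is injective and, for every $k\in G_1\setminus\{0\}$, the difference map $i\mapsto\varphi(i+k)-\varphi(i)$ from $G_1$ to $G_2$ is injective. -}

module Defs where

open import Level using (Level; _⊔_)
open import Algebra.Bundles using (AbelianGroup)
open import Data.Nat using (ℕ; suc; _+_; _%_)
open import Data.Nat.DivMod using (m%n<n)
open import Data.Nat.Primality using (Prime)
open import Data.Fin using (Fin; toℕ; fromℕ<)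
open import Data.Product using (Σ; ∃; _×_; _,_)
open import Relation.Binary.PropositionalEquality using (_≡_)
open import Relation.Nullary using (¬_)

HasOrder : ∀ {c ℓ} → AbelianGroup c ℓ → ℕ → Set (c ⊔ ℓ)
HasOrder G n = Σ (Fin n → Carrier) λ f →
    (∀ i j → f i ≈ f j → i ≡ j) × (∀ x → ∃ λ i → f i ≈ x)
  where open AbelianGroup G

IsCircularCostas : ∀ {c₁ ℓ₁ c₂ ℓ₂} (G₁ : AbelianGroup c₁ ℓ₁) (G₂ : AbelianGroup c₂ ℓ₂) →
                   (AbelianGroup.Carrier G₁ → AbelianGroup.Carrier G₂) → Set (c₁ ⊔ ℓ₁ ⊔ ℓ₂)
IsCircularCostas G₁ G₂ φ =
    (∀ x y → x ≈₁ y → φ x ≈₂ φ y)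
  × (∀ x y → φ x ≈₂ φ y → x ≈₁ y)
  × (∀ k → ¬ (k ≈₁ ε₁) →
       ∀ i j → (φ (i +₁ k) -₂ φ i) ≈₂ (φ (j +₁ k) -₂ φ j) → i ≈₁ j)
  where
  open AbelianGroup G₁ using () renaming (_≈_ to _≈₁_; _∙_ to _+₁_; ε to ε₁)
  open AbelianGroup G₂ using () renaming (_≈_ to _≈₂_; _-_ to _-₂_)

_+ₘ_ : ∀ {q} → Fin (suc q) → Fin (suc q) → Fin (suc q)
_+ₘ_ {q} a b = fromℕ< (m%n<n (toℕ a + toℕ b) (suc q))

-- G is isomorphic (as a group) to ℤ_(suc q)^m, modelled as Fin m → Fin (suc q)
-- with componentwise addition mod (suc q) and pointwise equality.
IsoToZpm : ∀ {c ℓ} → AbelianGroup c ℓ → ℕ → ℕ → Set (c ⊔ ℓ)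
IsoToZpm G q m = Σ (Carrier → (Fin m → Fin (suc q))) λ ψ →
    (∀ x y → x ≈ y → ∀ t → ψ x t ≡ ψ y t)
  × (∀ x y → (∀ t → ψ x t ≡ ψ y t) → x ≈ y)
  × (∀ (v : Fin m → Fin (suc q)) → ∃ λ x → ∀ t → ψ x t ≡ v t)
  × (∀ x y t → ψ (x ∙ y) t ≡ (ψ x t +ₘ ψ y t))
  where open AbelianGroup G

IsElementaryAbelian : ∀ {c ℓ} → AbelianGroup c ℓ → Set (c ⊔ ℓ)
IsElementaryAbelian G = ∃ λ q → Prime (suc q) × ∃ λ m → IsoToZpm G q m

{-# OPTIONS --safe #-}

-- After a translation φ omits 0.  Let D and E be the formal sums of the elements
-- (x , φ x) and of their inverses in the group ring 𝔽ₚ[G₁ × G₂], where p is a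
-- prime divisor of |G₂|, and let u, t and w be the sums over G₁ × 0, 0 × G₂ and
-- G₁ × G₂.  The Costas condition says DE + u + t = w, and this forces
-- DᵖE + u = w.  By Frobenius Dᵖ is the sum of the elements (px , p φ x), so every
-- element of G₁ × G₂ outside G₁ × 0 has the form (px , p φ x) - (y , φ y).  There
-- are |G₁|² such elements and |G₁|² pairs (x , y), hence no pair yields an element
-- of G₁ × 0: p φ x is never a value of φ, so it is 0, and p annihilates G₂.

module Submission where

open import Defs
open import Level using (_⊔_; 0ℓ)
open import Algebra.Bundles using (AbelianGroup; CommutativeMonoid; CommutativeSemiring)
import Algebra.Construct.DirectProduct as DirectProduct
import Algebra.Definitions.RawMonoid as RawMonoidDefs
import Algebra.Structures.Biased as Biased
open import Data.Bool using (true; false; if_then_else_)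
open import Data.Fin using (Fin; zero; suc; toℕ; fromℕ; fromℕ<; inject₁; punchIn; punchOut; combine; remQuot; finToFun; funToFin)
open import Data.Fin.Properties using (_≟_; any?; toℕ-fromℕ; toℕ-inject₁; toℕ<n; toℕ-injective; toℕ-fromℕ<; suc-injective; punchOut-injective; punchIn-punchOut; punchInᵢ≢i; injective⇒≤; combine-injective; combine-remQuot; finToFun-funToFin)
open import Data.List using (List; []; _∷_; _++_; foldr; map; tabulate; cartesianProductWith)
open import Data.List.Properties using (++-assoc)
open import Data.List.Relation.Unary.All using (_∷_)
open import Data.Nat as ℕ using (ℕ; zero; suc; z≤n; s≤s; _∸_; _!; _%_; NonZero)
open import Data.Nat.Combinatorics using (_C_; nCn≡1; nCk≡n!/k![n-k]!; k![n∸k]!∣n!)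
open import Data.Nat.Coprimality using (Coprime; coprime-Bézout)
open import Data.Nat.Divisibility using (_∣_; _∣?_; divides; ∣-refl; ∣-trans; ∣⇒≤; ∣1⇒≡1; m∣m*n; ∣m⇒∣m*n; n∣m⇒m%n≡0)
open import Data.Nat.DivMod using (_/_; m/n*n≡m; m%n<n; m≡m%n+[m/n]*n; m<n⇒m%n≡m; m*n%n≡0; [m+kn]%n≡m%n; %-distribˡ-+; %-remove-+ˡ)
open import Data.Nat.GCD using (module Bézout)
open import Data.Nat.ListAction using (product)
open import Data.Nat.Primality using (Prime; euclidsLemma; prime⇒irreducible; ¬prime[0]; ¬prime[1])
open import Data.Nat.Primality.Factorisation using (factorise)
import Data.Nat.Properties as ℕ
open import Data.Product using (Σ; ∃; ∃₂; _×_; _,_; proj₁; proj₂)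
open import Data.Sum using (_⊎_; inj₁; inj₂)
open import Data.Vec.Functional as Vector using (Vector)
open import Function using (_∘_)
open import Relation.Binary.PropositionalEquality as ≡ using (_≡_; _≢_)
open import Relation.Binary.Structures using (IsEquivalence)
open import Relation.Nullary using (¬_; Dec; yes; no; does; contradiction)
open import Relation.Nullary.Decidable using (_×-dec_; ¬?; map′; decidable-stable; dec-true; dec-false)

-- Characteristic p

-- The step to `DᵖE + u = w` rests on three facts. Since `p` divides |G₂|, |G₁| is -1 modulo `p`,
-- and this gives `Dw = −w`; moreover `Du = w − u` and `Dt = w`. Hence Dᵖ⁻¹ fixes `w`, sends `u` to
-- `u + w` and sends `t` to -w, so multiplying `DE + u + t = w` by Dᵖ⁻¹ gives DᵖE + (u + w) - w = w.
-- The result holds only modulo `p`: it shows that each element outside G₁ × 0 occurs at least once,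
-- while on G₁ × 0 it would still allow multiplicities that are positive multiples of `p`. The count
-- of pairs is what excludes these. Formal sums are lists, which form a semiring without
-- subtraction. A minus sign is therefore either moved to the other side or replaced by a factor
-- `p − 1`.

prime∣!⇒≤ : ∀ {p} → Prime p → ∀ n → p ∣ n ! → p ℕ.≤ n
prime∣!⇒≤ pr zero p∣1 = contradiction (≡.subst Prime (∣1⇒≡1 p∣1) pr) ¬prime[1]
prime∣!⇒≤ pr (suc n) p∣ with euclidsLemma (suc n) (n !) pr p∣
... | inj₁ p∣1+n = ∣⇒≤ p∣1+n
... | inj₂ p∣n!  = ℕ.m≤n⇒m≤1+n (prime∣!⇒≤ pr n p∣n!)

-- `p` divides `p !`, which is this coefficient times `k ! * (p ∸ k) !`, and it divides neither
-- factorial because `k` and `p ∸ k` are both below `p`.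
prime∣C : ∀ {p k} → Prime p → 0 ℕ.< k → k ℕ.< p → p ∣ p C k
prime∣C {suc p} {k} pr 0<k k<p =
  from-product (euclidsLemma (suc p C k) (k ! ℕ.* (suc p ∸ k) !) pr (≡.subst (suc p ∣_) (≡.sym C*≡!) (∣m⇒∣m*n (p !) ∣-refl)))
  where
  instance
    _ = ℕ._!*_!≢0 k (suc p ∸ k)
  C*≡! : (suc p C k) ℕ.* (k ! ℕ.* (suc p ∸ k) !) ≡ suc p !
  C*≡! = ≡.trans (≡.cong (ℕ._* (k ! ℕ.* (suc p ∸ k) !)) (nCk≡n!/k![n-k]! (ℕ.<⇒≤ k<p)))
                 (m/n*n≡m (k![n∸k]!∣n! (ℕ.<⇒≤ k<p)))
  from-product : (suc p ∣ suc p C k) ⊎ (suc p ∣ k ! ℕ.* (suc p ∸ k) !) → suc p ∣ suc p C k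
  from-product (inj₁ d) = d
  from-product (inj₂ d) with euclidsLemma (k !) _ pr d
  ... | inj₁ e = contradiction (prime∣!⇒≤ pr k e) (ℕ.<⇒≱ k<p)
  ... | inj₂ e = contradiction (prime∣!⇒≤ pr (suc p ∸ k) e)
                   (ℕ.<⇒≱ (ℕ.∸-monoʳ-< 0<k (ℕ.<⇒≤ k<p)))

module Characteristic {a ℓ} (S : CommutativeSemiring a ℓ) (q : ℕ) where

  open CommutativeSemiring S hiding (zero)
  open import Algebra.Properties.Semiring.Exp semiring using (_^_)
  open import Algebra.Properties.Semiring.Mult semiring
    using (×-homo-1; ×-assocˡ; ×-congˡ) renaming (_×_ to _⋆_)
  open import Algebra.Properties.Semiring.Sum semiring using (sum; sum-init-last; sum-cong-≋; sum-replicate-zero)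
  open import Algebra.Properties.CommutativeSemiring.Binomial S using (binomialTerm; theorem)
  open import Relation.Binary.Reasoning.Setoid setoid

  module _ (p⋆x≈0 : ∀ x → suc q ⋆ x ≈ 0#) where

    -- In characteristic `suc q` the multiple `q ⋆ z` serves as the negative of `z`.
    +-cancelʳ : ∀ z {x y} → x + z ≈ y + z → x ≈ y
    +-cancelʳ z {x} {y} x+z≈y+z = begin
      x                    ≈⟨ absorb x ⟨
      (x + z) + q ⋆ z      ≈⟨ +-congʳ x+z≈y+z ⟩
      (y + z) + q ⋆ z      ≈⟨ absorb y ⟩
      y                    ∎
      where
      absorb : ∀ x → (x + z) + q ⋆ z ≈ x
      absorb x = begin
        (x + z) + q ⋆ z  ≈⟨ +-assoc x z _ ⟩
        x + suc q ⋆ z    ≈⟨ +-congˡ (p⋆x≈0 z) ⟩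
        x + 0#           ≈⟨ +-identityʳ x ⟩
        x                ∎

    ∣⇒⋆≈0 : ∀ {n} → suc q ∣ n → ∀ x → n ⋆ x ≈ 0#
    ∣⇒⋆≈0 {n} (divides c n≡cp) x = begin
      n ⋆ x                ≈⟨ ×-congˡ {x} (≡.trans n≡cp (ℕ.*-comm c (suc q))) ⟩
      (suc q ℕ.* c) ⋆ x    ≈⟨ ×-assocˡ x (suc q) c ⟨
      suc q ⋆ (c ⋆ x)      ≈⟨ p⋆x≈0 _ ⟩
      0#                   ∎

    frobenius-+ : Prime (suc q) → ∀ x y → (x + y) ^ suc q ≈ x ^ suc q + y ^ suc q
    frobenius-+ pr x y = begin
      (x + y) ^ suc q                          ≈⟨ theorem (suc q) x y ⟩
      t zero + sum (t ∘ suc)                   ≈⟨ +-congˡ (sum-init-last (t ∘ suc)) ⟩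
      t zero + (sum (t ∘ suc ∘ inject₁) + t (suc (fromℕ q)))
        ≈⟨ +-cong first (+-cong (trans (sum-cong-≋ middle) (sum-replicate-zero q)) last) ⟩
      y ^ suc q + (0# + x ^ suc q)             ≈⟨ +-congˡ (+-identityˡ _) ⟩
      y ^ suc q + x ^ suc q                    ≈⟨ +-comm _ _ ⟩
      x ^ suc q + y ^ suc q                    ∎
      where
      t : Fin (suc (suc q)) → Carrier
      t = binomialTerm x y (suc q)

      first : t zero ≈ y ^ suc q
      first = trans (×-homo-1 _) (*-identityˡ _)

      middle : ∀ i → t (suc (inject₁ i)) ≈ 0#
      middle i = ∣⇒⋆≈0 (prime∣C pr (s≤s z≤n)
        (s≤s (≡.subst (ℕ._< q) (≡.sym (toℕ-inject₁ i)) (toℕ<n i)))) _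

      last : t (suc (fromℕ q)) ≈ x ^ suc q
      last = begin
        t (suc (fromℕ q))                             ≡⟨ ≡.cong (λ k → (suc q C suc k) ⋆ (x ^ suc k * y ^ (q ∸ k))) (toℕ-fromℕ q) ⟩
        (suc q C suc q) ⋆ (x ^ suc q * y ^ (q ∸ q))   ≡⟨ ≡.cong₂ (λ c k → c ⋆ (x ^ suc q * y ^ k)) (nCn≡1 (suc q)) (ℕ.n∸n≡0 q) ⟩
        1 ⋆ (x ^ suc q * 1#)                          ≈⟨ ×-homo-1 _ ⟩
        x ^ suc q * 1#                                ≈⟨ *-identityʳ _ ⟩
        x ^ suc q                                     ∎

module FrobeniusIdentity {s ℓ} (S : CommutativeSemiring s ℓ) (k : ℕ) where

  open CommutativeSemiring S hiding (zero)
  open import Algebra.Properties.Semiring.Exp semiring using (_^_)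
  open import Algebra.Properties.Semiring.Mult semiring using () renaming (_×_ to _⋆_)
  open import Algebra.Solver.CommutativeMonoid +-commutativeMonoid using (solve; _⊕_; _⊜_)
  open import Relation.Binary.Reasoning.Setoid setoid
  open Characteristic S (suc k)

  private
    -- The form `suc (suc k)` makes two things available: the factor `(1 + D)²` of `(1 + D)ᵖ`, and
    -- Dᵖ⁻² as `D ^ k`.
    p : ℕ
    p = suc (suc k)

  1^n≈1 : ∀ n → 1# ^ n ≈ 1#
  1^n≈1 zero    = refl
  1^n≈1 (suc n) = trans (*-identityˡ _) (1^n≈1 n)

  -- 1 + D kills w and (1 + D)² kills u, so Dᵖ = (1 + D)ᵖ - 1 acts as -1 on
  -- both; hence D, ..., Dᵖ act invertibly on the span of u and w.
  frobenius-identity : Prime p → (∀ x → p ⋆ x ≈ 0#) → ∀ {D E u t w} →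
    D * w + w ≈ 0# → D * u + u ≈ w → D * t ≈ w → D * E + u + t ≈ w →
    D ^ p * E + u ≈ w
  frobenius-identity pr char {D} {E} {u} {t} {w} Dw+w Du+u Dt DE = +-cancelʳ char w (begin
    K + u + w                        ≈⟨ +-congˡ (sym b+w+w≈w) ⟩
    K + u + (b + w + w)              ≈⟨ solve 4 (λ K u b w → (K ⊕ u) ⊕ ((b ⊕ w) ⊕ w) ⊜ ((K ⊕ (u ⊕ w)) ⊕ b) ⊕ w) refl K u b w ⟩
    K + (u + w) + b + w              ≈⟨ +-congʳ (+-congʳ (+-congˡ (sym c≈u+w))) ⟩
    K + c + b + w                    ≈⟨ +-congʳ K+c+b≈w ⟩
    w + w                            ∎)
    where
    -- Multiplying `DE` by `D ^ suc k` gives `K + c + b ≈ w`, where `b` stands for `D ^ suc k * t`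
    -- because `D * t ≈ w`. Since `c` is `u + w` and `b` is -w, this is the claim; adding `w` to
    -- both sides avoids the minus sign.
    K = D ^ p * E
    a = D ^ suc k * w
    b = D ^ k * w
    c = D ^ suc k * u

    shift : ∀ n x → D ^ n * (D * x) ≈ D ^ suc n * x
    shift n x = trans (sym (*-assoc _ _ _)) (*-congʳ (*-comm _ _))

    D^n-kills : ∀ n → D ^ suc n * w + D ^ n * w ≈ 0#
    D^n-kills n = begin
      D ^ suc n * w + D ^ n * w       ≈⟨ +-congʳ (shift n w) ⟨
      D ^ n * (D * w) + D ^ n * w     ≈⟨ distribˡ _ _ _ ⟨
      D ^ n * (D * w + w)             ≈⟨ *-congˡ Dw+w ⟩
      D ^ n * 0#                      ≈⟨ zeroʳ _ ⟩
      0#                              ∎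

    1+D : ∀ x → (1# + D) * x ≈ D * x + x
    1+D x = trans (distribʳ x 1# D) (trans (+-comm _ _) (+-congˡ (*-identityˡ x)))

    D^p-negates : ∀ x → (1# + D) * ((1# + D) * x) ≈ 0# → D ^ p * x + x ≈ 0#
    D^p-negates x kill = begin
      D ^ p * x + x                         ≈⟨ +-congˡ (trans (*-congʳ (1^n≈1 p)) (*-identityˡ x)) ⟨
      D ^ p * x + 1# ^ p * x                ≈⟨ +-comm _ _ ⟩
      1# ^ p * x + D ^ p * x                ≈⟨ distribʳ x _ _ ⟨
      (1# ^ p + D ^ p) * x                  ≈⟨ *-congʳ (frobenius-+ char pr 1# D) ⟨
      (1# + D) ^ p * x                      ≈⟨ *-congʳ (trans (sym (*-assoc _ _ _)) (*-comm _ _)) ⟩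
      ((1# + D) ^ k * ((1# + D) * (1# + D))) * x   ≈⟨ *-assoc _ _ _ ⟩
      (1# + D) ^ k * (((1# + D) * (1# + D)) * x)   ≈⟨ *-congˡ (trans (*-assoc _ _ _) kill) ⟩
      (1# + D) ^ k * 0#                     ≈⟨ zeroʳ _ ⟩
      0#                                    ∎

    D^p-w : D ^ p * w + w ≈ 0#
    D^p-w = D^p-negates w (trans (*-congˡ (trans (1+D w) Dw+w)) (zeroʳ _))

    D^p-u : D ^ p * u + u ≈ 0#
    D^p-u = D^p-negates u (trans (*-congˡ (trans (1+D u) Du+u)) (trans (1+D w) Dw+w))

    -- Both sides are negatives of `D ^ p * w`.
    a≈w : a ≈ w
    a≈w = +-cancelʳ char (D ^ p * w) (trans (+-comm _ _) (trans (D^n-kills (suc k)) (trans (sym D^p-w) (+-comm _ _))))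

    b+w≈0 : b + w ≈ 0#
    b+w≈0 = trans (+-congˡ (sym a≈w)) (trans (+-comm _ _) (D^n-kills k))

    b+w+w≈w : b + w + w ≈ w
    b+w+w≈w = trans (+-congʳ b+w≈0) (+-identityˡ w)

    -- `D ^ p * u + c` is `D ^ suc k * (D * u + u)`, that is `a`, that is `w`, and `D ^ p * u` is
    -- the negative of `u`.
    c≈u+w : c ≈ u + w
    c≈u+w = +-cancelʳ char (D ^ p * u) (begin
      c + D ^ p * u               ≈⟨ +-comm _ _ ⟩
      D ^ p * u + c               ≈⟨ +-congʳ (shift (suc k) u) ⟨
      D ^ suc k * (D * u) + c     ≈⟨ distribˡ _ _ _ ⟨
      D ^ suc k * (D * u + u)     ≈⟨ *-congˡ Du+u ⟩
      a                           ≈⟨ a≈w ⟩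
      w                           ≈⟨ +-identityˡ w ⟨
      0# + w                      ≈⟨ +-congʳ D^p-u ⟨
      D ^ p * u + u + w           ≈⟨ solve 3 (λ x u w → (x ⊕ u) ⊕ w ⊜ (u ⊕ w) ⊕ x) refl _ u w ⟩
      u + w + D ^ p * u           ∎)

    K+c+b≈w : K + c + b ≈ w
    K+c+b≈w = begin
      K + c + b                             ≈⟨ +-cong (+-congʳ (sym (shift (suc k) E))) (trans (*-congˡ (sym Dt)) (shift k t)) ⟩
      D ^ suc k * (D * E) + c + D ^ suc k * t  ≈⟨ +-congʳ (distribˡ _ _ _) ⟨
      D ^ suc k * (D * E + u) + D ^ suc k * t  ≈⟨ distribˡ _ _ _ ⟨
      D ^ suc k * (D * E + u + t)           ≈⟨ *-congˡ DE ⟩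
      a                                     ≈⟨ a≈w ⟩
      w                                     ∎

-- The group ring

module Summation {v ℓᵥ} (V : CommutativeMonoid v ℓᵥ) where

  open CommutativeMonoid V
  open RawMonoidDefs rawMonoid using () renaming (_×_ to _×ᵥ_)
  open import Algebra.Properties.CommutativeMonoid.Sum V
  open import Relation.Binary.Reasoning.Setoid setoid

  -- Opaque, because unification cannot recover the summand (nor the range) from
  -- an unfolded sum.
  opaque
    ∑ : ∀ {m} → (Fin m → Carrier) → Carrier
    ∑ = sum

    ∑-cong : ∀ {m} {f g : Fin m → Carrier} → (∀ i → f i ≈ g i) → ∑ f ≈ ∑ g
    ∑-cong = sum-cong-≋

    ∑-suc : ∀ {m} (f : Fin (suc m) → Carrier) → ∑ f ≈ f zero ∙ ∑ (f ∘ suc)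
    ∑-suc f = refl

    ∑-∙ : ∀ {m} (f g : Fin m → Carrier) → ∑ (λ i → f i ∙ g i) ≈ ∑ f ∙ ∑ g
    ∑-∙ = ∑-distrib-+

    ∑-swap : ∀ {k m} (f : Fin k → Fin m → Carrier) →
      ∑ (λ i → ∑ (λ j → f i j)) ≈ ∑ (λ j → ∑ (λ i → f i j))
    ∑-swap = ∑-comm

    ∑-const : ∀ m {x} → ∑ {m} (λ _ → x) ≈ m ×ᵥ x
    ∑-const m = sum-replicate m

    ∑-ε : ∀ m → ∑ {m} (λ _ → ε) ≈ ε
    ∑-ε = sum-replicate-zero

    ∑-remove : ∀ {m} (f : Fin (suc m) → Carrier) i → ∑ f ≈ f i ∙ ∑ (f ∘ punchIn i)
    ∑-remove f i = sum-remove {i = i} f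

  -- Induction on `m`: after the value at `zero` is removed from the range, `punchOut` turns the
  -- other values into an injective self-map of a smaller `Fin`.
  ∑-injective : ∀ {m} (f : Fin m → Carrier) {σ : Fin m → Fin m} →
    (∀ i j → σ i ≡ σ j → i ≡ j) → ∑ (f ∘ σ) ≈ ∑ f
  ∑-injective {zero}  f σ-inj = ∑-cong λ ()
  ∑-injective {suc m} f {σ} σ-inj = begin
    ∑ (f ∘ σ)                            ≈⟨ ∑-suc _ ⟩
    f s ∙ ∑ (f ∘ σ ∘ suc)                ≈⟨ ∙-congˡ (∑-cong (λ i → reflexive (≡.cong f (≡.sym (punchIn-punchOut (s≢ i)))))) ⟩
    f s ∙ ∑ (f ∘ punchIn s ∘ τ)          ≈⟨ ∙-congˡ (∑-injective (f ∘ punchIn s) τ-inj) ⟩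
    f s ∙ ∑ (f ∘ punchIn s)              ≈⟨ ∑-remove f s ⟨
    ∑ f                                  ∎
    where
    s = σ zero
    s≢ : ∀ i → s ≢ σ (suc i)
    s≢ i eq with () ← σ-inj zero (suc i) eq
    τ : Fin m → Fin m
    τ i = punchOut (s≢ i)
    τ-inj : ∀ i j → τ i ≡ τ j → i ≡ j
    τ-inj i j eq = suc-injective (σ-inj _ _ (punchOut-injective (s≢ i) (s≢ j) eq))

  ∑-δ : ∀ {m} (k : Fin m) x → ∑ (λ i → if does (i ≟ k) then x else ε) ≈ x
  ∑-δ {suc m} k x = begin
    ∑ δ                            ≈⟨ ∑-remove δ k ⟩
    δ k ∙ ∑ (δ ∘ punchIn k)        ≈⟨ ∙-cong at-k (trans (∑-cong off-k) (∑-ε m)) ⟩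
    x ∙ ε                          ≈⟨ identityʳ x ⟩
    x                              ∎
    where
    δ : Fin (suc m) → Carrier
    δ i = if does (i ≟ k) then x else ε
    at-k : δ k ≈ x
    at-k = reflexive (≡.cong (if_then x else ε) (dec-true (k ≟ k) ≡.refl))
    off-k : ∀ i → δ (punchIn k i) ≈ ε
    off-k i = reflexive (≡.cong (if_then x else ε) (dec-false (punchIn k i ≟ k) (punchInᵢ≢i k i)))

-- Formal sums of elements of A; two of them are identified when every
-- V-valued function on A has the same sum over both.  For V = ℕ modulo p this
-- is the group ring of A over 𝔽ₚ.
module GroupRing {a ℓ v ℓᵥ} (A : CommutativeMonoid a ℓ) (V : CommutativeMonoid v ℓᵥ) where

  private
    module A = CommutativeMonoid A
    module V = CommutativeMonoid V
  open V using () renaming (_∙_ to _+_; _≈_ to _~_; ε to 0#)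
  open Summation V using (∑; ∑-cong)
  open RawMonoidDefs A.rawMonoid using () renaming (_×_ to _·_)
  open RawMonoidDefs V.rawMonoid using () renaming (_×_ to _×ᵥ_)
  open import Algebra.Properties.CommutativeSemigroup V.commutativeSemigroup using (interchange)
  open import Relation.Binary.Reasoning.Setoid V.setoid

  ∫ : List A.Carrier → (A.Carrier → V.Carrier) → V.Carrier
  ∫ xs f = foldr (λ x s → f x + s) 0# xs

  Congruent : (A.Carrier → V.Carrier) → Set (a ⊔ ℓ ⊔ ℓᵥ)
  Congruent f = ∀ {x y} → x A.≈ y → f x ~ f y

  infix 4 _≋_
  -- Integration against test functions takes the place of comparing coefficients. The test
  -- functions are congruent so that replacing an entry by one equal to it under `A.≈` does not
  -- change the formal sum.
  record _≋_ (xs ys : List A.Carrier) : Set (a ⊔ ℓ ⊔ v ⊔ ℓᵥ) where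
    constructor mk≋
    field
      ∫≈ : ∀ f → Congruent f → ∫ xs f ~ ∫ ys f
  open _≋_ public

  infixl 7 _⊛_
  _⊛_ : List A.Carrier → List A.Carrier → List A.Carrier
  _⊛_ = cartesianProductWith A._∙_

  ∫-cong : ∀ xs {f g} → (∀ x → f x ~ g x) → ∫ xs f ~ ∫ xs g
  ∫-cong []       f~g = V.refl
  ∫-cong (x ∷ xs) f~g = V.∙-cong (f~g x) (∫-cong xs f~g)

  ∫-++ : ∀ xs ys f → ∫ (xs ++ ys) f ~ ∫ xs f + ∫ ys f
  ∫-++ []       ys f = V.sym (V.identityˡ _)
  ∫-++ (x ∷ xs) ys f = V.trans (V.∙-congˡ (∫-++ xs ys f)) (V.sym (V.assoc _ _ _))

  ∫-map : ∀ (h : A.Carrier → A.Carrier) xs f → ∫ (map h xs) f ≡ ∫ xs (f ∘ h)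
  ∫-map h []       f = ≡.refl
  ∫-map h (x ∷ xs) f = ≡.cong (f (h x) +_) (∫-map h xs f)

  opaque
    unfolding ∑

    family : ∀ {n} → (Fin n → A.Carrier) → List A.Carrier
    family = tabulate

    ∫-family : ∀ {n} (e : Fin n → A.Carrier) f → ∫ (family e) f ~ ∑ (f ∘ e)
    ∫-family {zero}  e f = V.refl
    ∫-family {suc n} e f = V.∙-congˡ (∫-family (e ∘ suc) f)

  ∫-zero : ∀ xs → ∫ xs (λ _ → 0#) ~ 0#
  ∫-zero []       = V.refl
  ∫-zero (x ∷ xs) = V.trans (V.identityˡ _) (∫-zero xs)

  ∫-+ : ∀ xs f g → ∫ xs (λ x → f x + g x) ~ ∫ xs f + ∫ xs g
  ∫-+ []       f g = V.sym (V.identityˡ _)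
  ∫-+ (x ∷ xs) f g = V.trans (V.∙-congˡ (∫-+ xs f g)) (interchange _ _ _ _)

  ∫-swap : ∀ xs ys (f : A.Carrier → A.Carrier → V.Carrier) →
           ∫ xs (λ x → ∫ ys (f x)) ~ ∫ ys (λ y → ∫ xs (λ x → f x y))
  ∫-swap []       ys f = V.sym (∫-zero ys)
  ∫-swap (x ∷ xs) ys f = V.trans (V.∙-congˡ (∫-swap xs ys f)) (V.sym (∫-+ ys _ _))

  ∫-⊛ : ∀ xs ys f → ∫ (xs ⊛ ys) f ~ ∫ xs (λ x → ∫ ys (λ y → f (x A.∙ y)))
  ∫-⊛ []       ys f = V.refl
  ∫-⊛ (x ∷ xs) ys f = begin
    ∫ (map (x A.∙_) ys ++ xs ⊛ ys) f            ≈⟨ ∫-++ (map (x A.∙_) ys) (xs ⊛ ys) f ⟩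
    ∫ (map (x A.∙_) ys) f + ∫ (xs ⊛ ys) f       ≈⟨ V.∙-cong (V.reflexive (∫-map (x A.∙_) ys f)) (∫-⊛ xs ys f) ⟩
    ∫ (x ∷ xs) (λ x → ∫ ys (λ y → f (x A.∙ y))) ∎

  private
    ++-cong : ∀ {xs xs′ ys ys′} → xs ≋ xs′ → ys ≋ ys′ → xs ++ ys ≋ xs′ ++ ys′
    ++-cong {xs} {xs′} {ys} {ys′} p q = mk≋ λ f f-cong → begin
      ∫ (xs ++ ys) f       ≈⟨ ∫-++ xs ys f ⟩
      ∫ xs f + ∫ ys f      ≈⟨ V.∙-cong (∫≈ p f f-cong) (∫≈ q f f-cong) ⟩
      ∫ xs′ f + ∫ ys′ f    ≈⟨ ∫-++ xs′ ys′ f ⟨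
      ∫ (xs′ ++ ys′) f     ∎

    ++-comm : ∀ xs ys → xs ++ ys ≋ ys ++ xs
    ++-comm xs ys = mk≋ λ f _ →
      V.trans (∫-++ xs ys f) (V.trans (V.comm _ _) (V.sym (∫-++ ys xs f)))

    ⊛-comm : ∀ xs ys → xs ⊛ ys ≋ ys ⊛ xs
    ⊛-comm xs ys = mk≋ λ f f-cong → begin
      ∫ (xs ⊛ ys) f                          ≈⟨ ∫-⊛ xs ys f ⟩
      ∫ xs (λ x → ∫ ys (λ y → f (x A.∙ y)))  ≈⟨ ∫-swap xs ys _ ⟩
      ∫ ys (λ y → ∫ xs (λ x → f (x A.∙ y)))  ≈⟨ ∫-cong ys (λ y → ∫-cong xs (λ x → f-cong (A.comm x y))) ⟩
      ∫ ys (λ y → ∫ xs (λ x → f (y A.∙ x)))  ≈⟨ ∫-⊛ ys xs f ⟨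
      ∫ (ys ⊛ xs) f                          ∎

    -- For a fixed `x` the translate of a congruent test function by `x` is again congruent, so the
    -- hypothesis applies to it.
    ⊛-congˡ : ∀ xs {ys ys′} → ys ≋ ys′ → xs ⊛ ys ≋ xs ⊛ ys′
    ⊛-congˡ xs {ys} {ys′} q = mk≋ λ f f-cong → begin
      ∫ (xs ⊛ ys) f                           ≈⟨ ∫-⊛ xs ys f ⟩
      ∫ xs (λ x → ∫ ys (λ y → f (x A.∙ y)))   ≈⟨ ∫-cong xs (λ x → ∫≈ q _ (f-cong ∘ A.∙-congˡ)) ⟩
      ∫ xs (λ x → ∫ ys′ (λ y → f (x A.∙ y)))  ≈⟨ ∫-⊛ xs ys′ f ⟨
      ∫ (xs ⊛ ys′) f                          ∎

    ≋-trans : ∀ {xs ys zs} → xs ≋ ys → ys ≋ zs → xs ≋ zs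
    ≋-trans p q = mk≋ λ f f-cong → V.trans (∫≈ p f f-cong) (∫≈ q f f-cong)

    ⊛-cong : ∀ {xs xs′ ys ys′} → xs ≋ xs′ → ys ≋ ys′ → xs ⊛ ys ≋ xs′ ⊛ ys′
    ⊛-cong {xs} {xs′} {ys} {ys′} p q =
      ≋-trans (⊛-congˡ xs q) (≋-trans (⊛-comm xs ys′) (≋-trans (⊛-congˡ ys′ p) (⊛-comm ys′ xs′)))

    ⊛-assoc : ∀ xs ys zs → (xs ⊛ ys) ⊛ zs ≋ xs ⊛ (ys ⊛ zs)
    ⊛-assoc xs ys zs = mk≋ λ f f-cong → begin
      ∫ ((xs ⊛ ys) ⊛ zs) f                                               ≈⟨ ∫-⊛ (xs ⊛ ys) zs f ⟩
      ∫ (xs ⊛ ys) (λ u → ∫ zs (λ z → f (u A.∙ z)))                       ≈⟨ ∫-⊛ xs ys _ ⟩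
      ∫ xs (λ x → ∫ ys (λ y → ∫ zs (λ z → f ((x A.∙ y) A.∙ z))))         ≈⟨ ∫-cong xs (λ x → ∫-cong ys λ y → ∫-cong zs λ z → f-cong (A.assoc x y z)) ⟩
      ∫ xs (λ x → ∫ ys (λ y → ∫ zs (λ z → f (x A.∙ (y A.∙ z)))))         ≈⟨ ∫-cong xs (λ x → ∫-⊛ ys zs _) ⟨
      ∫ xs (λ x → ∫ (ys ⊛ zs) (λ u → f (x A.∙ u)))                       ≈⟨ ∫-⊛ xs (ys ⊛ zs) f ⟨
      ∫ (xs ⊛ (ys ⊛ zs)) f                                               ∎

    ⊛-identityˡ : ∀ xs → (A.ε ∷ []) ⊛ xs ≋ xs
    ⊛-identityˡ xs = mk≋ λ f f-cong → begin
      ∫ ((A.ε ∷ []) ⊛ xs) f                ≈⟨ ∫-⊛ (A.ε ∷ []) xs f ⟩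
      ∫ xs (λ x → f (A.ε A.∙ x)) + 0#      ≈⟨ V.identityʳ _ ⟩
      ∫ xs (λ x → f (A.ε A.∙ x))           ≈⟨ ∫-cong xs (λ x → f-cong (A.identityˡ x)) ⟩
      ∫ xs f                               ∎

    ⊛-distribʳ-++ : ∀ xs ys zs → (ys ++ zs) ⊛ xs ≋ ys ⊛ xs ++ zs ⊛ xs
    ⊛-distribʳ-++ xs ys zs = mk≋ λ f _ → begin
      ∫ ((ys ++ zs) ⊛ xs) f              ≈⟨ ∫-⊛ (ys ++ zs) xs f ⟩
      ∫ (ys ++ zs) _                     ≈⟨ ∫-++ ys zs _ ⟩
      ∫ ys _ + ∫ zs _                    ≈⟨ V.∙-cong (∫-⊛ ys xs f) (∫-⊛ zs xs f) ⟨
      ∫ (ys ⊛ xs) f + ∫ (zs ⊛ xs) f      ≈⟨ ∫-++ (ys ⊛ xs) (zs ⊛ xs) f ⟨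
      ∫ (ys ⊛ xs ++ zs ⊛ xs) f           ∎

  ∫-⊛-family : ∀ {k l} (g : Fin k → A.Carrier) (h : Fin l → A.Carrier) f →
    ∫ (family g ⊛ family h) f ~ ∑ (λ i → ∑ (λ j → f (g i A.∙ h j)))
  ∫-⊛-family g h f = begin
    ∫ (family g ⊛ family h) f                       ≈⟨ ∫-⊛ (family g) (family h) f ⟩
    ∫ (family g) (λ x → ∫ (family h) (λ y → f (x A.∙ y))) ≈⟨ ∫-family g _ ⟩
    ∑ (λ i → ∫ (family h) (λ y → f (g i A.∙ y)))    ≈⟨ ∑-cong (λ i → ∫-family h _) ⟩
    ∑ (λ i → ∑ (λ j → f (g i A.∙ h j)))             ∎

  commutativeSemiring : CommutativeSemiring a (a ⊔ ℓ ⊔ v ⊔ ℓᵥ)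
  commutativeSemiring = record
    { _≈_ = _≋_ ; _+_ = _++_ ; _*_ = _⊛_ ; 0# = [] ; 1# = A.ε ∷ []
    ; isCommutativeSemiring = Biased.IsCommutativeSemiringˡ.isCommutativeSemiring record
      { +-isCommutativeMonoid = Biased.IsCommutativeMonoidˡ.isCommutativeMonoid record
        { isSemigroup = record
          { isMagma = record { isEquivalence = ≋-isEquivalence ; ∙-cong = ++-cong }
          ; assoc   = λ xs ys zs → ≡⇒≋ (++-assoc xs ys zs) }
        ; identityˡ = λ xs → ≡⇒≋ ≡.refl
        ; comm      = ++-comm }
      ; *-isCommutativeMonoid = Biased.IsCommutativeMonoidˡ.isCommutativeMonoid record
        { isSemigroup = record
          { isMagma = record { isEquivalence = ≋-isEquivalence ; ∙-cong = ⊛-cong }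
          ; assoc   = ⊛-assoc }
        ; identityˡ = ⊛-identityˡ
        ; comm      = ⊛-comm }
      ; distribʳ = ⊛-distribʳ-++
      ; zeroˡ    = λ xs → ≡⇒≋ ≡.refl
      }
    }
    where
    ≋-isEquivalence : IsEquivalence _≋_
    ≋-isEquivalence = record
      { refl  = mk≋ λ _ _ → V.refl
      ; sym   = λ p → mk≋ λ f f-cong → V.sym (∫≈ p f f-cong)
      ; trans = ≋-trans }

    ≡⇒≋ : ∀ {xs ys} → xs ≡ ys → xs ≋ ys
    ≡⇒≋ ≡.refl = mk≋ λ _ _ → V.refl

  private
    module R = CommutativeSemiring commutativeSemiring
  open import Algebra.Properties.Semiring.Exp R.semiring using (_^_)
  open import Algebra.Properties.Semiring.Mult R.semiring using () renaming (_×_ to _⋆_)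

  ∫-⋆ : ∀ n xs f → ∫ (n ⋆ xs) f ~ n ×ᵥ ∫ xs f
  ∫-⋆ zero    xs f = V.refl
  ∫-⋆ (suc n) xs f = V.trans (∫-++ xs (n ⋆ xs) f) (V.∙-congˡ (∫-⋆ n xs f))

  module _ (q : ℕ) (char : ∀ x → suc q ×ᵥ x ~ 0#) where

    ⋆-char : ∀ xs → suc q ⋆ xs ≋ []
    ⋆-char xs = mk≋ λ f _ → V.trans (∫-⋆ (suc q) xs f) (char _)

    -- Additivity of the Frobenius map splits off one entry at a time, and a power of a one-element
    -- sum is the one-element sum of the multiple.
    frobenius : Prime (suc q) → ∀ xs → xs ^ suc q ≋ map (suc q ·_) xs
    frobenius pr []       = R.refl
    frobenius pr (x ∷ xs) = R.trans
      (Characteristic.frobenius-+ commutativeSemiring q ⋆-char pr (x ∷ []) xs)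
      (R.+-cong (monomial (suc q)) (frobenius pr xs))
      where
      monomial : ∀ n → (x ∷ []) ^ n ≋ n · x ∷ []
      monomial zero    = R.refl
      monomial (suc n) = R.*-congˡ {x ∷ []} (monomial n)

-- Finite groups given by an enumeration

-- If `j` were missed, punching it out would inject `Fin (suc m)` into `Fin m`.
injective⇒surjective : ∀ {m} {σ : Fin m → Fin m} → (∀ i j → σ i ≡ σ j → i ≡ j) → ∀ j → ∃ λ i → σ i ≡ j
injective⇒surjective {suc m} {σ} σ-inj j with any? (λ i → σ i ≟ j)
... | yes hit  = hit
... | no  miss = contradiction
      (injective⇒≤ {f = λ i → punchOut {i = j} (λ j≡σi → miss (i , ≡.sym j≡σi))}
        (λ {i} {i′} eq → σ-inj i i′ (punchOut-injective (λ e → miss (i , ≡.sym e)) (λ e → miss (i′ , ≡.sym e)) eq)))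
      (ℕ.<⇒≱ ℕ.≤-refl)

module Enumeration {c ℓ} (G : AbelianGroup c ℓ) {m} (ord : HasOrder G m) where

  open AbelianGroup G

  enum : Fin m → Carrier
  enum = proj₁ ord

  enum-injective : ∀ i j → enum i ≈ enum j → i ≡ j
  enum-injective = proj₁ (proj₂ ord)

  index : Carrier → Fin m
  index x = proj₁ (proj₂ (proj₂ ord) x)

  enum-index : ∀ x → enum (index x) ≈ x
  enum-index x = proj₂ (proj₂ (proj₂ ord) x)

  index-cong : ∀ {x y} → x ≈ y → index x ≡ index y
  index-cong x≈y = enum-injective _ _ (trans (enum-index _) (trans x≈y (sym (enum-index _))))

  index-injective : ∀ {x y} → index x ≡ index y → x ≈ y
  index-injective eq = trans (sym (enum-index _)) (trans (reflexive (≡.cong enum eq)) (enum-index _))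

  index-enum : ∀ i → index (enum i) ≡ i
  index-enum i = enum-injective _ _ (enum-index _)

  _≈?_ : ∀ x y → Dec (x ≈ y)
  x ≈? y = map′ index-injective index-cong (index x ≟ index y)

  module _ {h : Fin m → Carrier} (h-injective : ∀ i j → h i ≈ h j → i ≡ j) where

    index∘h-injective : ∀ i j → index (h i) ≡ index (h j) → i ≡ j
    index∘h-injective i j eq = h-injective i j (index-injective eq)

    hit : ∀ x → ∃ λ i → h i ≈ x
    hit x with i , eq ← injective⇒surjective index∘h-injective (index x) = i , index-injective eq

  module _ {v ℓᵥ} (V : CommutativeMonoid v ℓᵥ) where

    private
      module V = CommutativeMonoid V
    open Summation V

    -- `index ∘ h` permutes `Fin m`. The changes of variable in the group ring identities
    -- (translations, values of φ, differences of φ) are all instances.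
    ∑-reindex : ∀ {h : Fin m → Carrier} → (∀ i j → h i ≈ h j → i ≡ j) →
      ∀ {f : Carrier → V.Carrier} → (∀ {x y} → x ≈ y → f x V.≈ f y) →
      ∑ (f ∘ h) V.≈ ∑ (f ∘ enum)
    ∑-reindex {h} h-injective f-cong = V.trans
      (∑-cong (λ i → f-cong (sym (enum-index (h i)))))
      (∑-injective _ (index∘h-injective h-injective))

-- Group ring identities for a circular Costas map that omits 0

module GroupRingIdentities
  {c₁ ℓ₁ c₂ ℓ₂} (G₁ : AbelianGroup c₁ ℓ₁) (G₂ : AbelianGroup c₂ ℓ₂) {n : ℕ}
  (ord₁ : HasOrder G₁ n) (ord₂ : HasOrder G₂ (suc n))
  (φ : AbelianGroup.Carrier G₁ → AbelianGroup.Carrier G₂)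
  (costas : IsCircularCostas G₁ G₂ φ)
  (φ≉ε : ∀ x → ¬ AbelianGroup._≈_ G₂ (φ x) (AbelianGroup.ε G₂))
  where

  private
    module G₁ = AbelianGroup G₁
    module G₂ = AbelianGroup G₂
    module E₁ = Enumeration G₁ ord₁
    module E₂ = Enumeration G₂ ord₂
  open import Algebra.Properties.Group G₁.group using () renaming (∙-cancelˡ to ∙₁-cancelˡ; identityʳ-unique to identityʳ₁-unique)
  open import Algebra.Properties.Group G₂.group using () renaming (∙-cancelˡ to ∙₂-cancelˡ; x∙y⁻¹≈ε⇒x≈y to x-y≈ε⇒x≈y)
  open import Algebra.Properties.AbelianGroup G₁ using () renaming (xyx⁻¹≈y to xyx⁻¹≈₁y)

  a : Fin n → G₁.Carrier
  a = E₁.enum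

  b : Fin (suc n) → G₂.Carrier
  b = E₂.enum

  φ-cong : ∀ {x y} → x G₁.≈ y → φ x G₂.≈ φ y
  φ-cong = proj₁ costas _ _

  φ-injective : ∀ {x y} → φ x G₂.≈ φ y → x G₁.≈ y
  φ-injective = proj₁ (proj₂ costas) _ _

  Δ : G₁.Carrier → G₁.Carrier → G₂.Carrier
  Δ k x = φ (x G₁.∙ k) G₂.- φ x

  Δ-injective : ∀ k → ¬ k G₁.≈ G₁.ε → ∀ {x y} → Δ k x G₂.≈ Δ k y → x G₁.≈ y
  Δ-injective k k≉ε = proj₂ (proj₂ costas) k k≉ε _ _

  -- `n` distinct nonzero elements together with `ε` exhaust G₂, which has order `suc n`. Both the
  -- values of φ and the differences `Δ k` for nonzero `k` are completed in this way.
  with-ε : (Fin n → G₂.Carrier) → Fin (suc n) → G₂.Carrier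
  with-ε h zero    = G₂.ε
  with-ε h (suc i) = h i

  with-ε-injective : ∀ {h} → (∀ i j → h i G₂.≈ h j → i ≡ j) → (∀ i → ¬ h i G₂.≈ G₂.ε) →
    ∀ i j → with-ε h i G₂.≈ with-ε h j → i ≡ j
  with-ε-injective inj h≉ε zero    zero    eq = ≡.refl
  with-ε-injective inj h≉ε zero    (suc j) eq = contradiction (G₂.sym eq) (h≉ε j)
  with-ε-injective inj h≉ε (suc i) zero    eq = contradiction eq (h≉ε i)
  with-ε-injective inj h≉ε (suc i) (suc j) eq = ≡.cong suc (inj i j eq)

  φa+ε-injective : ∀ i j → with-ε (φ ∘ a) i G₂.≈ with-ε (φ ∘ a) j → i ≡ j
  φa+ε-injective = with-ε-injective (λ i j eq → E₁.enum-injective i j (φ-injective eq)) (φ≉ε ∘ a)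

  -- A difference `Δ k x` is never `ε`: otherwise φ would agree at `x` and `x ∙ k`, forcing `k` to
  -- be `ε`.
  Δ+ε-injective : ∀ k → ¬ k G₁.≈ G₁.ε →
    ∀ i j → with-ε (Δ k ∘ a) i G₂.≈ with-ε (Δ k ∘ a) j → i ≡ j
  Δ+ε-injective k k≉ε = with-ε-injective
    (λ i j eq → E₁.enum-injective i j (Δ-injective k k≉ε eq))
    (λ i eq → k≉ε (identityʳ₁-unique (a i) k (φ-injective (x-y≈ε⇒x≈y _ _ eq))))

  module _ {v ℓᵥ} (V : CommutativeMonoid v ℓᵥ) where

    private
      module V = CommutativeMonoid V
    open V using () renaming (_∙_ to _+_; _≈_ to _~_; ε to 0#)
    open RawMonoidDefs V.rawMonoid using () renaming (_×_ to _×ᵥ_)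
    open Summation V
    open import Algebra.Properties.Monoid.Mult V.monoid using (×-congʳ)
    A : CommutativeMonoid (c₁ ⊔ c₂) (ℓ₁ ⊔ ℓ₂)
    A = AbelianGroup.commutativeMonoid (DirectProduct.abelianGroup G₁ G₂)
    open GroupRing A V
    private
      module R = CommutativeSemiring commutativeSemiring
    open import Algebra.Properties.Semiring.Mult R.semiring using () renaming (_×_ to _⋆_)
    open import Relation.Binary.Reasoning.Setoid V.setoid

    -- `w` is a product instead of an enumeration of pairs so that in `D ⊛ w` the factor `D` can be
    -- moved past `u` onto `t`.
    D E u t w : List (G₁.Carrier × G₂.Carrier)
    D = family λ i → a i , φ (a i)
    E = family λ i → a i G₁.⁻¹ , φ (a i) G₂.⁻¹
    u = family λ i → a i , G₂.ε
    t = family λ j → G₁.ε , b j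
    w = u ⊛ t

    module _ {f : G₁.Carrier × G₂.Carrier → V.Carrier} (f-cong : Congruent f) where

      ∫w : ∫ w f ~ ∑ (λ i → ∑ (λ j → f (a i , b j)))
      ∫w = V.trans (∫-⊛-family _ _ f)
        (∑-cong λ i → ∑-cong λ j → f-cong (G₁.identityʳ _ , G₂.identityˡ _))

      ∑-translate₁ : ∀ x y → ∑ (λ i → f (x G₁.∙ a i , y)) ~ ∑ (λ i → f (a i , y))
      ∑-translate₁ x y = E₁.∑-reindex V
        (λ i j eq → E₁.enum-injective i j (∙₁-cancelˡ x _ _ eq))
        (λ eq → f-cong (eq , G₂.refl))

      ∑-translate₂ : ∀ x y → ∑ (λ j → f (x , y G₂.∙ b j)) ~ ∑ (λ j → f (x , b j))
      ∑-translate₂ x y = E₂.∑-reindex V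
        (λ i j eq → E₂.enum-injective i j (∙₂-cancelˡ y _ _ eq))
        (λ eq → f-cong (G₁.refl , eq))

      ∑-φ : ∀ x → f (x , G₂.ε) + ∑ (λ i → f (x , φ (a i))) ~ ∑ (λ j → f (x , b j))
      ∑-φ x = V.trans (V.sym (∑-suc _)) (E₂.∑-reindex V φa+ε-injective (λ eq → f-cong (G₁.refl , eq)))

      ∑-Δ : ∀ {k} → ¬ k G₁.≈ G₁.ε → ∀ x → f (x , G₂.ε) + ∑ (λ i → f (x , Δ k (a i))) ~ ∑ (λ j → f (x , b j))
      ∑-Δ {k} k≉ε x = V.trans (V.sym (∑-suc _)) (E₂.∑-reindex V (Δ+ε-injective k k≉ε) (λ eq → f-cong (G₁.refl , eq)))

    -- Multiplication by `(x , φ x)` carries 0 × G₂ onto x × G₂.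
    Dt≋w : D ⊛ t ≋ w
    Dt≋w = mk≋ λ f f-cong → begin
      ∫ (D ⊛ t) f                                            ≈⟨ ∫-⊛-family _ _ f ⟩
      ∑ (λ i → ∑ (λ j → f (a i G₁.∙ G₁.ε , φ (a i) G₂.∙ b j))) ≈⟨ ∑-cong (λ i → ∑-translate₂ f-cong _ _) ⟩
      ∑ (λ i → ∑ (λ j → f (a i G₁.∙ G₁.ε , b j)))        ≈⟨ ∑-cong (λ i → ∑-cong λ j → f-cong (G₁.identityʳ _ , G₂.refl)) ⟩
      ∑ (λ i → ∑ (λ j → f (a i , b j)))                  ≈⟨ ∫w f-cong ⟨
      ∫ w f                                                  ∎

    -- Multiplication by `(x , φ x)` carries G₁ × 0 onto G₁ × φ x. As φ takes every nonzero value
    -- once, only G₁ × 0 is missing, and the extra `u` supplies it.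
    Du+u≋w : D ⊛ u ++ u ≋ w
    Du+u≋w = mk≋ λ f f-cong → begin
      ∫ (D ⊛ u ++ u) f                                       ≈⟨ ∫-++ (D ⊛ u) u f ⟩
      ∫ (D ⊛ u) f + ∫ u f                                    ≈⟨ V.∙-cong (∫-⊛-family _ _ f) (∫-family _ f) ⟩
      ∑ (λ i → ∑ (λ j → f (a i G₁.∙ a j , φ (a i) G₂.∙ G₂.ε))) + ∑ (λ j → f (a j , G₂.ε))
        ≈⟨ V.∙-congʳ (∑-cong λ i → V.trans (∑-translate₁ f-cong _ _) (∑-cong λ j → f-cong (G₁.refl , G₂.identityʳ _))) ⟩
      ∑ (λ i → ∑ (λ j → f (a j , φ (a i)))) + ∑ (λ j → f (a j , G₂.ε))
        ≈⟨ V.comm _ _ ⟩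
      ∑ (λ j → f (a j , G₂.ε)) + ∑ (λ i → ∑ (λ j → f (a j , φ (a i))))
        ≈⟨ V.∙-congˡ (∑-swap (λ i j → f (a j , φ (a i)))) ⟩
      ∑ (λ j → f (a j , G₂.ε)) + ∑ (λ j → ∑ (λ i → f (a j , φ (a i))))
        ≈⟨ ∑-∙ _ _ ⟨
      ∑ (λ j → f (a j , G₂.ε) + ∑ (λ i → f (a j , φ (a i))))
        ≈⟨ ∑-cong (λ j → ∑-φ f-cong (a j)) ⟩
      ∑ (λ j → ∑ (λ i → f (a j , b i)))                  ≈⟨ ∫w f-cong ⟨
      ∫ w f                                                  ∎

    uu≋nu : u ⊛ u ≋ n ⋆ u
    uu≋nu = mk≋ λ f f-cong → begin
      ∫ (u ⊛ u) f                                            ≈⟨ ∫-⊛-family _ _ f ⟩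
      ∑ (λ i → ∑ (λ j → f (a i G₁.∙ a j , G₂.ε G₂.∙ G₂.ε)))
        ≈⟨ ∑-cong (λ i → V.trans (∑-translate₁ f-cong _ _) (∑-cong λ j → f-cong (G₁.refl , G₂.identityʳ _))) ⟩
      ∑ {n} (λ i → ∑ (λ j → f (a j , G₂.ε)))             ≈⟨ ∑-const n ⟩
      n ×ᵥ ∑ (λ j → f (a j , G₂.ε))                        ≈⟨ ×-congʳ n (∫-family _ f) ⟨
      n ×ᵥ ∫ u f                                             ≈⟨ ∫-⋆ n u f ⟨
      ∫ (n ⋆ u) f                                            ∎

    module _ (char : ∀ x → suc n ×ᵥ x ~ 0#) where

      -- `D w = u (D t) = u w = (u u) t = n w`, and `suc n` copies of `w` vanish.
      Dw+w≋0 : D ⊛ w ++ w ≋ []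
      Dw+w≋0 = R.trans (R.+-congʳ Dw≋nw) (R.trans (R.+-comm (n ⋆ w) w)
        (mk≋ λ f _ → V.trans (∫-⋆ (suc n) w f) (char _)))
        where
        open import Algebra.Properties.CommutativeSemigroup R.*-commutativeSemigroup using (x∙yz≈y∙xz)
        open import Algebra.Properties.Semiring.Mult R.semiring using (×-assoc-*)
        Dw≋nw : D ⊛ w ≋ n ⋆ w
        Dw≋nw = R.trans (x∙yz≈y∙xz D u t) (R.trans (R.*-congˡ {u} Dt≋w) (R.trans (R.sym (R.*-assoc u u t))
          (R.trans (R.*-congʳ uu≋nu) (×-assoc-* n u t))))

      -- Substituting x = y + k in DE collects, for each k, the differences
      -- φ (y + k) - φ y; these run over G₂ ∖ 0 when k ≉ ε.
      DE+u+t≋w : D ⊛ E ++ u ++ t ≋ w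
      DE+u+t≋w = mk≋ λ f f-cong → begin
        ∫ (D ⊛ E ++ u ++ t) f                                  ≈⟨ ∫-++ (D ⊛ E) (u ++ t) f ⟩
        ∫ (D ⊛ E) f + ∫ (u ++ t) f                             ≈⟨ V.∙-cong (∫DE f-cong) (∫-++ u t f) ⟩
        ∑ (λ k → ∑ (λ i → f (a k , Δ (a k) (a i)))) + (∫ u f + ∫ t f)
          ≈⟨ V.assoc _ _ _ ⟨
        (∑ (λ k → ∑ (λ i → f (a k , Δ (a k) (a i)))) + ∫ u f) + ∫ t f
          ≈⟨ V.∙-cong (V.trans (V.∙-congˡ (∫-family _ f)) (V.comm _ _))
                      (V.trans (∫-family _ f) (V.sym (∑-δ (E₁.index G₁.ε) _))) ⟩
        (∑ (λ k → f (a k , G₂.ε)) + ∑ (λ k → ∑ (λ i → f (a k , Δ (a k) (a i))))) + ∑ (diagonal f)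
          ≈⟨ V.∙-congʳ (V.sym (∑-∙ _ _)) ⟩
        ∑ (λ k → f (a k , G₂.ε) + ∑ (λ i → f (a k , Δ (a k) (a i)))) + ∑ (diagonal f)
          ≈⟨ ∑-∙ _ _ ⟨
        ∑ (λ k → (f (a k , G₂.ε) + ∑ (λ i → f (a k , Δ (a k) (a i)))) + diagonal f k)
          ≈⟨ ∑-cong (row f f-cong) ⟩
        ∑ (λ k → ∑ (λ j → f (a k , b j)))                  ≈⟨ ∫w f-cong ⟨
        ∫ w f                                                  ∎
        where
        -- The contribution of `t`, concentrated in the row `k = 0`, written as a sum over all rows
        -- so that the identity can be checked row by row.
        diagonal : (G₁.Carrier × G₂.Carrier → V.Carrier) → Fin n → V.Carrier
        diagonal f k = if does (k ≟ E₁.index G₁.ε) then ∑ (λ j → f (G₁.ε , b j)) else 0#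

        module _ {f : G₁.Carrier × G₂.Carrier → V.Carrier} (f-cong : Congruent f) where
          ∫DE : ∫ (D ⊛ E) f ~ ∑ (λ k → ∑ (λ i → f (a k , Δ (a k) (a i))))
          ∫DE = begin
            ∫ (D ⊛ E) f                                        ≈⟨ ∫-⊛-family _ _ f ⟩
            ∑ (λ j → ∑ (λ i → f (a j G₁.- a i , φ (a j) G₂.- φ (a i))))
              ≈⟨ ∑-swap (λ j i → f (a j G₁.- a i , φ (a j) G₂.- φ (a i))) ⟩
            ∑ (λ i → ∑ (λ j → f (a j G₁.- a i , φ (a j) G₂.- φ (a i))))
              ≈⟨ ∑-cong (λ i → E₁.∑-reindex V
                   (λ j k eq → E₁.enum-injective j k (∙₁-cancelˡ (a i) _ _ eq))
                   (λ eq → f-cong (G₁.∙-congʳ eq , G₂.∙-congʳ (φ-cong eq)))) ⟨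
            ∑ (λ i → ∑ (λ k → f ((a i G₁.∙ a k) G₁.- a i , φ (a i G₁.∙ a k) G₂.- φ (a i))))
              ≈⟨ ∑-cong (λ i → ∑-cong λ k → f-cong (xyx⁻¹≈₁y (a i) (a k) , G₂.refl)) ⟩
            ∑ (λ i → ∑ (λ k → f (a k , Δ (a k) (a i))))    ≈⟨ ∑-swap (λ i k → f (a k , Δ (a k) (a i))) ⟩
            ∑ (λ k → ∑ (λ i → f (a k , Δ (a k) (a i))))    ∎

        -- For `k ≠ 0` the differences miss only `ε`, which `u` supplies. For `k = 0` all `n`
        -- differences are `ε`; with the entry of `u` they make `suc n` equal terms, which cancel,
        -- and `t` supplies the whole row.
        row : ∀ f → Congruent f → ∀ k →
          (f (a k , G₂.ε) + ∑ (λ i → f (a k , Δ (a k) (a i)))) + diagonal f k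
          ~ ∑ (λ j → f (a k , b j))
        row f f-cong k with k ≟ E₁.index G₁.ε
        ... | no k≢ = V.trans (V.identityʳ _) (∑-Δ f-cong
                (λ eq → k≢ (E₁.enum-injective _ _ (G₁.trans eq (G₁.sym (E₁.enum-index G₁.ε))))) (a k))
        ... | yes ≡.refl = begin
          (f (a k , G₂.ε) + ∑ (λ i → f (a k , Δ (a k) (a i)))) + ∑ (λ j → f (G₁.ε , b j))
            ≈⟨ V.∙-cong (V.trans (V.∙-congˡ (V.trans (∑-cong λ i → f-cong (G₁.refl , Δ≈ε i)) (∑-const n))) (char _))
                        (∑-cong λ j → f-cong (G₁.sym ak≈ε , G₂.refl)) ⟩
          0# + ∑ (λ j → f (a k , b j))    ≈⟨ V.identityˡ _ ⟩
          ∑ (λ j → f (a k , b j))         ∎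
          where
          ak≈ε : a k G₁.≈ G₁.ε
          ak≈ε = E₁.enum-index G₁.ε
          Δ≈ε : ∀ i → Δ (a k) (a i) G₂.≈ G₂.ε
          Δ≈ε i = G₂.trans (G₂.∙-congʳ (φ-cong (G₁.trans (G₁.∙-congˡ ak≈ε) (G₁.identityʳ _)))) (G₂.inverseʳ _)

-- A record, so that m and n can be inferred from a proof of congruence.
record _≡_[mod_] (m n p : ℕ) .{{_ : NonZero p}} : Set where
  constructor mod
  field
    %≡ : m % p ≡ n % p
open _≡_[mod_]

+-monoid-mod : (p : ℕ) .{{_ : NonZero p}} → CommutativeMonoid 0ℓ 0ℓ
+-monoid-mod p = record
  { Carrier = ℕ
  ; _≈_     = _≡_[mod p ]
  ; _∙_     = ℕ._+_
  ; ε       = 0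
  ; isCommutativeMonoid = record
    { isMonoid = record
      { isSemigroup = record
        { isMagma = record
          { isEquivalence = record
            { refl  = mod ≡.refl
            ; sym   = λ m~n → mod (≡.sym (%≡ m~n))
            ; trans = λ l~m m~n → mod (≡.trans (%≡ l~m) (%≡ m~n))
            }
          ; ∙-cong = λ {m} {m′} {n} {n′} m~m′ n~n′ → mod (≡.trans (%-distribˡ-+ m n p)
              (≡.trans (≡.cong₂ (λ x y → (x ℕ.+ y) % p) (%≡ m~m′) (%≡ n~n′)) (≡.sym (%-distribˡ-+ m′ n′ p))))
          }
        ; assoc = λ l m n → ≡⇒≡mod (ℕ.+-assoc l m n)
        }
      ; identity = (λ n → ≡⇒≡mod ≡.refl) , (λ n → ≡⇒≡mod (ℕ.+-identityʳ n))
      }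
    ; comm = λ m n → ≡⇒≡mod (ℕ.+-comm m n)
    }
  }
  where
  ≡⇒≡mod : ∀ {m n} → m ≡ n → m ≡ n [mod p ]
  ≡⇒≡mod m≡n = mod (≡.cong (_% p) m≡n)

-- Applied with `m = p` for the characteristic of the group ring, and with `m` the order of G₂,
-- where it makes |G₁| act as -1.
×-mod : ∀ p .{{_ : NonZero p}} {m} → p ∣ m → ∀ x →
  RawMonoidDefs._×_ (CommutativeMonoid.rawMonoid (+-monoid-mod p)) m x ≡ 0 [mod p ]
×-mod p {m} p∣m x = mod (≡.trans (≡.cong (_% p) (×≡* m))
  (≡.trans (n∣m⇒m%n≡0 (m ℕ.* x) p (∣-trans p∣m (m∣m*n x))) (≡.sym (m*n%n≡0 0 p))))
  where
  ×≡* : ∀ m → RawMonoidDefs._×_ (CommutativeMonoid.rawMonoid (+-monoid-mod p)) m x ≡ m ℕ.* x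
  ×≡* zero    = ≡.refl
  ×≡* (suc m) = ≡.cong (x ℕ.+_) (×≡* m)

∃-prime-divisor : ∀ n → ∃ λ p → Prime p × p ∣ suc (suc n)
∃-prime-divisor n with factorise (suc (suc n))
... | record { factors = p ∷ ps ; isFactorisation = eq ; factorsPrime = pr ∷ _ } =
  p , pr , divides (product ps) (≡.trans eq (ℕ.*-comm p (product ps)))

-- A prime divisor of |G₂| annihilates G₂

module Exponent
  {c₁ ℓ₁ c₂ ℓ₂} (G₁ : AbelianGroup c₁ ℓ₁) (G₂ : AbelianGroup c₂ ℓ₂) {n : ℕ}
  (ord₁ : HasOrder G₁ n) (ord₂ : HasOrder G₂ (suc n))
  (φ : AbelianGroup.Carrier G₁ → AbelianGroup.Carrier G₂)
  (costas : IsCircularCostas G₁ G₂ φ)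
  (φ≉ε : ∀ x → ¬ AbelianGroup._≈_ G₂ (φ x) (AbelianGroup.ε G₂))
  (k : ℕ) (pr : Prime (suc (suc k))) (p∣∣G₂∣ : suc (suc k) ∣ suc n)
  where

  private
    p : ℕ
    p = suc (suc k)
    V : CommutativeMonoid 0ℓ 0ℓ
    V = +-monoid-mod p
    module G₁ = AbelianGroup G₁
    module G₂ = AbelianGroup G₂
    module V = CommutativeMonoid V
    module E₁ = Enumeration G₁ ord₁
    module E₂ = Enumeration G₂ ord₂
  open GroupRingIdentities G₁ G₂ ord₁ ord₂ φ costas φ≉ε
  private
    module A = CommutativeMonoid (A V)
  open GroupRing (A V) V
  open Summation V
  private
    module R = CommutativeSemiring commutativeSemiring
  open RawMonoidDefs G₂.rawMonoid using () renaming (_×_ to _·₂_)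
  open RawMonoidDefs A.rawMonoid using () renaming (_×_ to _·_)
  open import Algebra.Properties.Monoid.Mult G₂.monoid using (×-congʳ)
  open import Relation.Binary.Reasoning.Setoid V.setoid

  pD : List A.Carrier
  pD = map (p ·_) (D V)

  pDE+u≋w : pD ⊛ E V ++ u V ≋ w V
  pDE+u≋w = R.trans (R.+-congʳ (R.*-congʳ (R.sym (frobenius (suc k) (×-mod p ∣-refl) pr (D V)))))
    (FrobeniusIdentity.frobenius-identity commutativeSemiring k pr (⋆-char (suc k) (×-mod p ∣-refl))
      {D V} {E V} {u V} {t V} {w V}
      (Dw+w≋0 V (×-mod p p∣∣G₂∣)) (Du+u≋w V) (Dt≋w V)
      (R.trans (R.+-assoc (D V ⊛ E V) (u V) (t V)) (DE+u+t≋w V (×-mod p p∣∣G₂∣))))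

  module _ (i₀ i₁ : Fin n) where

    -- Since φ enumerates the nonzero elements of G₂, the index pairs `(i₀ , i₁)` parametrise the
    -- elements outside G₁ × 0, which makes sources and targets equal in number.
    Hits : Fin n → Fin n → Set (ℓ₁ ⊔ ℓ₂)
    Hits i j = (p · (a i , φ (a i))) A.∙ (a j G₁.⁻¹ , φ (a j) G₂.⁻¹) A.≈ (a i₀ , φ (a i₁))

    private
      j₀ : Fin (suc n)
      j₀ = E₂.index (φ (a i₁))

      -- The indicator of the target: `∫ xs f` is its coefficient in `xs` modulo `p`.
      f : A.Carrier → ℕ
      f (x , y) = if does (E₁.index x ≟ i₀) then (if does (E₂.index y ≟ j₀) then 1 else 0) else 0

      f-cong : Congruent f
      f-cong (x≈x′ , y≈y′) = V.reflexive (≡.cong₂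
        (λ i j → if does (i ≟ i₀) then (if does (j ≟ j₀) then 1 else 0) else 0)
        (E₁.index-cong x≈x′) (E₂.index-cong y≈y′))

      f-off : ∀ {x y} → ¬ ((x , y) A.≈ (a i₀ , φ (a i₁))) → f (x , y) ≡ 0
      f-off {x} {y} off with E₁.index x ≟ i₀ | E₂.index y ≟ j₀
      ... | no _     | _      = ≡.refl
      ... | yes _    | no _   = ≡.refl
      ... | yes x↦i₀ | yes y↦j₀ = contradiction
        (G₁.trans (G₁.sym (E₁.enum-index x)) (G₁.reflexive (≡.cong a x↦i₀)) , E₂.index-injective y↦j₀) off

      ∫wf≈1 : ∫ (w V) f V.≈ 1
      ∫wf≈1 = begin
        ∫ (w V) f                                             ≈⟨ ∫w V f-cong ⟩
        ∑ (λ i → ∑ (λ j → f (a i , b j)))                     ≈⟨ ∑-cong inner ⟩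
        ∑ (λ i → if does (i ≟ i₀) then 1 else 0)              ≈⟨ ∑-δ i₀ 1 ⟩
        1                                                     ∎
        where
        inner : ∀ i → ∑ (λ j → f (a i , b j)) V.≈ (if does (i ≟ i₀) then 1 else 0)
        inner i rewrite E₁.index-enum i with does (i ≟ i₀)
        ... | false = ∑-ε (suc n)
        ... | true  = V.trans
          (∑-cong λ j → V.reflexive (≡.cong (λ j → if does (j ≟ j₀) then 1 else 0) (E₂.index-enum j)))
          (∑-δ j₀ 1)

      ∫uf≈0 : ∫ (u V) f V.≈ 0
      ∫uf≈0 = V.trans (∫-family _ f) (V.trans
        (∑-cong λ i → V.reflexive (f-off λ (_ , ε≈) → φ≉ε _ (G₂.sym ε≈))) (∑-ε n))

      ∫pDEf≈0 : (∀ i j → ¬ Hits i j) → ∫ (pD ⊛ E V) f V.≈ 0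
      ∫pDEf≈0 miss = begin
        ∫ (pD ⊛ E V) f                                        ≈⟨ ∫-⊛ pD (E V) f ⟩
        ∫ pD (λ x → ∫ (E V) (λ y → f (x A.∙ y)))              ≡⟨ ∫-map (p ·_) (D V) _ ⟩
        ∫ (D V) (λ x → ∫ (E V) (λ y → f ((p · x) A.∙ y)))     ≈⟨ ∫-family _ _ ⟩
        ∑ (λ i → ∫ (E V) (λ y → f ((p · (a i , φ (a i))) A.∙ y)))
          ≈⟨ ∑-cong (λ i → ∫-family _ _) ⟩
        ∑ (λ i → ∑ (λ j → f ((p · (a i , φ (a i))) A.∙ (a j G₁.⁻¹ , φ (a j) G₂.⁻¹))))
          ≈⟨ ∑-cong (λ i → ∑-cong λ j → V.reflexive (f-off (miss i j))) ⟩
        ∑ {n} (λ i → ∑ {n} (λ j → 0))                         ≈⟨ ∑-cong {n} (λ i → ∑-ε n) ⟩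
        ∑ {n} (λ i → 0)                                       ≈⟨ ∑-ε n ⟩
        0                                                     ∎

    -- The target has coefficient 1 in `w` and 0 in `u`, so its coefficient in `pD ⊛ E` is nonzero
    -- modulo `p`. The search over index pairs is finite and decidable, so refuting its failure
    -- yields a hit.
    ∃-hit : ∃₂ Hits
    ∃-hit = decidable-stable (any? λ i → any? λ j → (_ E₁.≈? _) ×-dec (_ E₂.≈? _)) λ none →
      0≉1 (begin
        0                                ≈⟨ V.∙-cong (∫pDEf≈0 λ i j h → none (i , j , h)) ∫uf≈0 ⟨
        ∫ (pD ⊛ E V) f ℕ.+ ∫ (u V) f     ≈⟨ ∫-++ (pD ⊛ E V) (u V) f ⟨
        ∫ (pD ⊛ E V ++ u V) f            ≈⟨ ∫≈ pDE+u≋w f f-cong ⟩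
        ∫ (w V) f                        ≈⟨ ∫wf≈1 ⟩
        1                                ∎)
      where
      0≉1 : ¬ (0 V.≈ 1)
      0≉1 (mod ())

  private
    Hit : Fin n × Fin n → Fin n × Fin n → Set (ℓ₁ ⊔ ℓ₂)
    Hit (i₀ , i₁) (i , j) = Hits i₀ i₁ i j

    -- Opaque, because the exhaustive search behind ∃-hit is too expensive to
    -- normalise during type checking.
    opaque
      source : Fin n × Fin n → Fin n × Fin n
      source (i₀ , i₁) = let i , j , _ = ∃-hit i₀ i₁ in i , j

      source-hits : ∀ x → Hit x (source x)
      source-hits (i₀ , i₁) = let _ , _ , hits = ∃-hit i₀ i₁ in hits

    -- A source pair yields a single group element, and this element determines both target indices
    -- because the enumeration and φ are injective.
    source-injective : ∀ x y → source x ≡ source y → x ≡ y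
    source-injective x@(i₀ , i₁) y@(i₀′ , i₁′) eq =
      let h₁ , h₂ = ≡.subst (Hit x) eq (source-hits x)
          h₁′ , h₂′ = source-hits y
      in ≡.cong₂ _,_
        (E₁.enum-injective _ _ (G₁.trans (G₁.sym h₁) h₁′))
        (E₁.enum-injective _ _ (φ-injective (G₂.trans (G₂.sym h₂) h₂′)))

    -- Pairs are coded in `Fin (n * n)`, where an injective self-map is surjective.
    source-surjective : ∀ i j → ∃ λ x → source x ≡ (i , j)
    source-surjective i j =
      let k , eq = injective⇒surjective {σ = σ} σ-injective (combine i j)
      in remQuot n k , combine-injective′ eq
      where
      combine² : Fin n × Fin n → Fin (n ℕ.* n)
      combine² (i , j) = combine i j
      combine-injective′ : ∀ {x y} → combine² x ≡ combine² y → x ≡ y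
      combine-injective′ {i , j} {i′ , j′} eq =
        let i≡i′ , j≡j′ = combine-injective i j i′ j′ eq in ≡.cong₂ _,_ i≡i′ j≡j′
      σ : Fin (n ℕ.* n) → Fin (n ℕ.* n)
      σ = combine² ∘ source ∘ remQuot n
      σ-injective : ∀ k l → σ k ≡ σ l → k ≡ l
      σ-injective k l eq = ≡.trans (≡.sym (combine-remQuot {n} n k)) (≡.trans
        (≡.cong combine² (source-injective _ _ (combine-injective′ eq))) (combine-remQuot {n} n l))

    proj₂-· : ∀ m x y → proj₂ (m · (x , y)) ≡ m ·₂ y
    proj₂-· zero    x y = ≡.refl
    proj₂-· (suc m) x y = ≡.cong (y G₂.∙_) (proj₂-· m x y)

  -- The n² pairs (i , j) hit all n² elements (x , y) with y ≉ ε, so none of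
  -- them is left to hit an element of G₁ × {ε}.
  p·φ≉φ : ∀ i j → ¬ (p ·₂ φ (a i) G₂.≈ φ (a j))
  p·φ≉φ i j eq =
    let x@(i₀ , i₁) , source≡ = source-surjective i j
        _ , h₂ = ≡.subst (Hit x) source≡ (source-hits x)
    in φ≉ε (a i₁) (G₂.trans (G₂.sym h₂)
      (G₂.trans (G₂.∙-congʳ (G₂.trans (G₂.reflexive (proj₂-· p (a i) (φ (a i)))) eq)) (G₂.inverseʳ _)))

  p·≈ε : ∀ y → p ·₂ y G₂.≈ G₂.ε
  p·≈ε y with E₂.hit φa+ε-injective y
  ... | zero  , ε≈y = G₂.trans (×-congʳ p (G₂.sym ε≈y)) (×-ε p)
    where
    ×-ε : ∀ m → m ·₂ G₂.ε G₂.≈ G₂.ε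
    ×-ε zero    = G₂.refl
    ×-ε (suc m) = G₂.trans (G₂.identityˡ _) (×-ε m)
  ... | suc i , φi≈y with E₂.hit φa+ε-injective (p ·₂ φ (a i))
  ...   | suc j , φj≈ = contradiction (G₂.sym φj≈) (p·φ≉φ i j)
  ...   | zero  , ε≈  = G₂.trans (×-congʳ p (G₂.sym φi≈y)) (G₂.sym ε≈)

-- Translating the map so that it omits 0

module _ {c₁ ℓ₁ c₂ ℓ₂} (G₁ : AbelianGroup c₁ ℓ₁) (G₂ : AbelianGroup c₂ ℓ₂) where

  private
    module G₁ = AbelianGroup G₁
    module G₂ = AbelianGroup G₂
  open RawMonoidDefs G₂.rawMonoid using () renaming (_×_ to _·_)
  open import Algebra.Properties.Group G₂.group using (∙-cancelʳ; x∙y⁻¹≈ε⇒x≈y; ⁻¹-anti-homo-//; //-rightDividesˡ)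
  open import Relation.Binary.Reasoning.Setoid G₂.setoid

  translate-costas : ∀ {φ} z → IsCircularCostas G₁ G₂ φ → IsCircularCostas G₁ G₂ (λ x → φ x G₂.- z)
  translate-costas {φ} z (φ-cong , φ-inj , Δ-inj) =
    (λ x y eq → G₂.∙-congʳ (φ-cong x y eq)) ,
    (λ x y eq → φ-inj x y (∙-cancelʳ _ _ _ eq)) ,
    (λ k k≉ε i j eq → Δ-inj k k≉ε i j (G₂.trans (G₂.sym (Δ-translate _ _)) (G₂.trans eq (Δ-translate _ _))))
    where
    Δ-translate : ∀ x y → (x G₂.- z) G₂.- (y G₂.- z) G₂.≈ x G₂.- y
    Δ-translate x y = begin
      (x G₂.- z) G₂.- (y G₂.- z)      ≈⟨ G₂.∙-congˡ (⁻¹-anti-homo-// y z) ⟩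
      (x G₂.- z) G₂.∙ (z G₂.- y)      ≈⟨ G₂.assoc _ _ _ ⟨
      ((x G₂.- z) G₂.∙ z) G₂.- y      ≈⟨ G₂.∙-congʳ (//-rightDividesˡ z x) ⟩
      x G₂.- y                        ∎

  module _ {n} (ord₁ : HasOrder G₁ n) (ord₂ : HasOrder G₂ (suc n))
    {φ : G₁.Carrier → G₂.Carrier} (φ-cong : ∀ x y → x G₁.≈ y → φ x G₂.≈ φ y)
    where

    private
      module E₁ = Enumeration G₁ ord₁
      module E₂ = Enumeration G₂ ord₂

    hit? : ∀ j → Dec (∃ λ i → φ (E₁.enum i) G₂.≈ E₂.enum j)
    hit? j = any? λ i → φ (E₁.enum i) E₂.≈? E₂.enum j

    -- Were every value attained, a choice of preimages would inject `Fin (suc n)` into `Fin n`.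
    missed-value : ∃ λ z → ∀ x → ¬ (φ x G₂.≈ z)
    missed-value with any? (λ j → ¬? (hit? j))
    ... | yes (j , miss) = E₂.enum j , λ x φx≈ →
          miss (E₁.index x , G₂.trans (φ-cong _ _ (E₁.enum-index x)) φx≈)
    ... | no all-hit = contradiction (injective⇒≤ {f = proj₁ ∘ preimage} preimage-injective) (ℕ.<⇒≱ ℕ.≤-refl)
      where
      preimage : ∀ j → ∃ λ i → φ (E₁.enum i) G₂.≈ E₂.enum j
      preimage j = decidable-stable (hit? j) λ miss → all-hit (j , miss)
      preimage-injective : ∀ {j j′} → proj₁ (preimage j) ≡ proj₁ (preimage j′) → j ≡ j′
      preimage-injective {j} {j′} eq = E₂.enum-injective _ _ (G₂.trans (G₂.sym (proj₂ (preimage j)))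
        (G₂.trans (G₂.reflexive (≡.cong (φ ∘ E₁.enum) eq)) (proj₂ (preimage j′))))

  costas⇒prime-exponent : ∀ {n} → HasOrder G₁ n → HasOrder G₂ (suc n) →
    ∀ {φ} → IsCircularCostas G₁ G₂ φ →
    ∃ λ q → Prime (suc q) × (∀ y → suc q · y G₂.≈ G₂.ε)
  -- G₁ contains `ε`, so it is not empty; hence |G₂| is at least 2 and has a prime divisor.
  costas⇒prime-exponent {zero} ord₁ ord₂ costas with () ← proj₁ (proj₂ (proj₂ ord₁) G₁.ε)
  costas⇒prime-exponent {suc n} ord₁ ord₂ {φ} costas with ∃-prime-divisor n
  ... | zero        , pr , p∣ = contradiction pr ¬prime[0]
  ... | suc zero    , pr , p∣ = contradiction pr ¬prime[1]
  ... | suc (suc k) , pr , p∣ =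
    let z , φ≉z = missed-value ord₁ ord₂ (proj₁ costas)
    in suc k , pr , Exponent.p·≈ε G₁ G₂ ord₁ ord₂ (λ x → φ x G₂.- z) (translate-costas z costas)
         (λ x eq → φ≉z x (x∙y⁻¹≈ε⇒x≈y _ _ eq)) k pr p∣

-- Groups of prime exponent

prime∤⇒coprime : ∀ {p c} → Prime p → ¬ p ∣ c → Coprime p c
prime∤⇒coprime pr p∤c (d∣p , d∣c) with prime⇒irreducible pr d∣p
... | inj₁ d≡1 = d≡1
... | inj₂ d≡p = contradiction (≡.subst (_∣ _) d≡p d∣c) p∤c

-- `e` is -1/c modulo the prime, obtained from a Bézout identity.
negated-inverse : ∀ {q c} → Prime (suc q) → ¬ suc q ∣ c → ∃ λ e → suc q ∣ suc (e ℕ.* c)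
negated-inverse {q} {c} pr p∤c with coprime-Bézout (prime∤⇒coprime pr p∤c)
... | Bézout.+- x y eq = y , divides x eq
-- Here `y` is the inverse of `c` itself, and `q`, which is -1 modulo `suc q`, corrects the sign.
... | Bézout.-+ x y eq = q ℕ.* y , divides (1 ℕ.+ q ℕ.* x) (begin
  suc (q ℕ.* y ℕ.* c)               ≡⟨ ≡.cong suc (ℕ.*-assoc q y c) ⟩
  suc (q ℕ.* (y ℕ.* c))             ≡⟨ ≡.cong (λ z → suc (q ℕ.* z)) eq ⟨
  suc (q ℕ.* (1 ℕ.+ x ℕ.* suc q))   ≡⟨ ≡.cong suc (ℕ.*-distribˡ-+ q 1 (x ℕ.* suc q)) ⟩
  suc (q ℕ.* 1 ℕ.+ q ℕ.* (x ℕ.* suc q))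
    ≡⟨ ≡.cong₂ (λ y z → suc (y ℕ.+ z)) (ℕ.*-identityʳ q) (≡.sym (ℕ.*-assoc q x (suc q))) ⟩
  (1 ℕ.+ q ℕ.* x) ℕ.* suc q         ∎)
  where open ≡.≡-Reasoning

-- With `q` as -1 modulo `suc q`, the divisibility says that `v` and `w` are congruent.
<p∧∣⇒≡ : ∀ {q v w} → v ℕ.< suc q → w ℕ.< suc q → suc q ∣ v ℕ.+ q ℕ.* w → v ≡ w
<p∧∣⇒≡ {q} {v} {w} v<p w<p p∣v+qw = begin
  v                                ≡⟨ m<n⇒m%n≡m v<p ⟨
  v % suc q                        ≡⟨ [m+kn]%n≡m%n v w (suc q) ⟨
  (v ℕ.+ w ℕ.* suc q) % suc q      ≡⟨ ≡.cong (_% suc q) regroup ⟩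
  (v ℕ.+ q ℕ.* w ℕ.+ w) % suc q    ≡⟨ %-remove-+ˡ w p∣v+qw ⟩
  w % suc q                        ≡⟨ m<n⇒m%n≡m w<p ⟩
  w                                ∎
  where
  open ≡.≡-Reasoning
  regroup : v ℕ.+ w ℕ.* suc q ≡ v ℕ.+ q ℕ.* w ℕ.+ w
  regroup = ≡.trans (≡.cong (v ℕ.+_) (≡.trans (ℕ.*-comm w (suc q)) (ℕ.+-comm w (q ℕ.* w))))
    (≡.sym (ℕ.+-assoc v (q ℕ.* w) w))

module PrimeExponent {c ℓ} (G : AbelianGroup c ℓ) {q : ℕ} (pr : Prime (suc q)) where

  open AbelianGroup G
  open RawMonoidDefs rawMonoid using () renaming (_×_ to _·_)
  open import Algebra.Properties.Monoid.Mult monoid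
    using (×-congʳ; ×-homo-+; ×-homo-1; ×-assocˡ)
  open import Algebra.Properties.CommutativeMonoid.Mult commutativeMonoid using (×-distrib-+)
  open import Algebra.Properties.CommutativeSemigroup commutativeSemigroup using (interchange)
  open import Relation.Binary.Reasoning.Setoid setoid

  private
    p : ℕ
    p = suc q

  comb : ∀ {m} → Vector Carrier m → Vector ℕ m → Carrier
  comb {zero}  b c = ε
  comb {suc m} b c = c zero · b zero ∙ comb (b ∘ suc) (c ∘ suc)

  ·-ε : ∀ n → n · ε ≈ ε
  ·-ε zero    = refl
  ·-ε (suc n) = trans (identityˡ _) (·-ε n)

  comb-+ : ∀ {m} (b : Vector Carrier m) c d → comb b (λ t → c t ℕ.+ d t) ≈ comb b c ∙ comb b d
  comb-+ {zero}  b c d = sym (identityˡ ε)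
  comb-+ {suc m} b c d = trans
    (∙-cong (×-homo-+ (b zero) (c zero) (d zero)) (comb-+ (b ∘ suc) (c ∘ suc) (d ∘ suc)))
    (interchange _ _ _ _)

  comb-* : ∀ {m} (b : Vector Carrier m) e c → comb b (λ t → e ℕ.* c t) ≈ e · comb b c
  comb-* {zero}  b e c = sym (·-ε e)
  comb-* {suc m} b e c = trans
    (∙-cong (sym (×-assocˡ (b zero) e (c zero))) (comb-* (b ∘ suc) e (c ∘ suc)))
    (sym (×-distrib-+ _ _ e))

  comb-cong : ∀ {m} (b : Vector Carrier m) {c d} → (∀ t → c t · b t ≈ d t · b t) → comb b c ≈ comb b d
  comb-cong {zero}  b eq = refl
  comb-cong {suc m} b eq = ∙-cong (eq zero) (comb-cong (b ∘ suc) (eq ∘ suc))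

  comb-≗ : ∀ {m} (b : Vector Carrier m) {c d} → (∀ t → c t ≡ d t) → comb b c ≈ comb b d
  comb-≗ b eq = comb-cong b λ t → reflexive (≡.cong (_· b t) (eq t))

  infix 4 _∈⟨_⟩
  _∈⟨_⟩ : ∀ {m} → Carrier → Vector Carrier m → Set ℓ
  x ∈⟨ b ⟩ = ∃ λ c → comb b c ≈ x

  -- Linear independence over 𝔽ₚ: coefficients are natural numbers, so a zero coefficient becomes
  -- one divisible by `p`.
  Independent : ∀ {m} → Vector Carrier m → Set ℓ
  Independent b = ∀ c → comb b c ≈ ε → ∀ t → p ∣ c t

  module _ (exponent : ∀ x → p · x ≈ ε) where

    ∣⇒·≈ε : ∀ {n} → p ∣ n → ∀ x → n · x ≈ ε
    ∣⇒·≈ε (divides k ≡.refl) x = trans (sym (×-assocˡ x k p)) (trans (×-congʳ k (exponent x)) (·-ε k))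

    %-· : ∀ n x → (n % p) · x ≈ n · x
    %-· n x = begin
      (n % p) · x                         ≈⟨ identityʳ _ ⟨
      (n % p) · x ∙ ε                     ≈⟨ ∙-congˡ (∣⇒·≈ε (divides (n / p) ≡.refl) x) ⟨
      (n % p) · x ∙ (n / p ℕ.* p) · x     ≈⟨ ×-homo-+ x (n % p) _ ⟨
      (n % p ℕ.+ n / p ℕ.* p) · x         ≡⟨ ≡.cong (_· x) (m≡m%n+[m/n]*n n p) ⟨
      n · x                               ∎

    residue : ℕ → Fin p
    residue n = fromℕ< (m%n<n n p)

    comb-residue : ∀ {m} (b : Vector Carrier m) c → comb b (toℕ ∘ residue ∘ c) ≈ comb b c
    comb-residue b c = comb-cong b λ t →
      trans (reflexive (≡.cong (_· b t) (toℕ-fromℕ< (m%n<n (c t) p)))) (%-· (c t) (b t))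

    module _ (_≈?_ : ∀ x y → Dec (x ≈ y)) where

      -- Coefficients matter only modulo `p`, so it suffices to search the finitely many vectors of
      -- residues, coded by `funToFin`.
      _∈?⟨_⟩ : ∀ {m} x (b : Vector Carrier m) → Dec (x ∈⟨ b ⟩)
      _∈?⟨_⟩ {m} x b = map′
        (λ (i , eq) → toℕ ∘ finToFun {p} {m} i , eq)
        (λ (c , eq) → funToFin (residue ∘ c) , trans
          (comb-≗ b λ t → ≡.cong toℕ (finToFun-funToFin (residue ∘ c) t)) (trans (comb-residue b c) eq))
        (any? λ i → comb b (toℕ ∘ finToFun {p} {m} i) ≈? x)

      -- If `p` did not divide `c zero`, scaling the relation by -1/(c zero) would express `x`
      -- through `b`.
      extend-independent : ∀ {m x} {b : Vector Carrier m} → ¬ x ∈⟨ b ⟩ → Independent b → Independent (x Vector.∷ b)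
      extend-independent {m} {x} {b} x∉b b-indep c eq = λ
        { zero → p∣c₀ ; (suc t) → b-indep (c ∘ suc) rest≈ε t }
        where
        S = comb b (c ∘ suc)

        p∣c₀ : p ∣ c zero
        p∣c₀ with p ∣? c zero
        ... | yes d = d
        ... | no p∤c₀ with negated-inverse pr p∤c₀
        ...   | e , p∣1+ec₀ = contradiction ((λ t → e ℕ.* c (suc t)) , (begin
          comb b (λ t → e ℕ.* c (suc t))              ≈⟨ comb-* b e (c ∘ suc) ⟩
          e · S                                       ≈⟨ identityˡ _ ⟨
          ε ∙ e · S                                   ≈⟨ ∙-congʳ (∣⇒·≈ε p∣1+ec₀ x) ⟨
          (x ∙ (e ℕ.* c zero) · x) ∙ e · S            ≈⟨ assoc _ _ _ ⟩
          x ∙ ((e ℕ.* c zero) · x ∙ e · S)            ≈⟨ ∙-congˡ (∙-congʳ (×-assocˡ x e (c zero))) ⟨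
          x ∙ (e · (c zero · x) ∙ e · S)              ≈⟨ ∙-congˡ (×-distrib-+ _ _ e) ⟨
          x ∙ e · (c zero · x ∙ S)                    ≈⟨ ∙-congˡ (trans (×-congʳ e eq) (·-ε e)) ⟩
          x ∙ ε                                       ≈⟨ identityʳ x ⟩
          x                                           ∎)) x∉b

        rest≈ε : S ≈ ε
        rest≈ε = trans (sym (identityˡ S)) (trans (∙-congʳ (sym (∣⇒·≈ε p∣c₀ x))) eq)

      -- Greedy selection from the end: a vector is kept exactly when it lies outside the span of
      -- those kept so far.
      basis : ∀ {k} (e : Vector Carrier k) →
        ∃ λ m → Σ (Vector Carrier m) λ b → Independent b × (∀ i → e i ∈⟨ b ⟩)
      basis {zero}  e = 0 , (λ ()) , (λ _ _ ()) , (λ ())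
      basis {suc k} e with basis (e ∘ suc)
      ... | m , b , indep , spans with e zero ∈?⟨ b ⟩
      ...   | yes e₀∈b = m , b , indep , λ { zero → e₀∈b ; (suc i) → spans i }
      ...   | no  e₀∉b = suc m , e zero Vector.∷ b , extend-independent e₀∉b indep , λ
        { zero    → 1 Vector.∷ (λ _ → 0) , trans (∙-cong (×-homo-1 _) (comb-0 b)) (identityʳ _)
        ; (suc i) → let c , eq = spans i in 0 Vector.∷ c , trans (identityˡ _) eq }
        where
        comb-0 : ∀ {m} (b : Vector Carrier m) → comb b (λ _ → 0) ≈ ε
        comb-0 {zero}  b = refl
        comb-0 {suc m} b = trans (identityˡ _) (comb-0 (b ∘ suc))

    module _ {m} {b : Vector Carrier m} (indep : Independent b) where

      -- The difference of the two combinations is written with coefficients `v + q * w`. As the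
      -- combinations agree, its value is `p` times one of them, hence `ε`.
      comb-injective : ∀ (v w : Fin m → Fin p) → comb b (toℕ ∘ v) ≈ comb b (toℕ ∘ w) → ∀ t → v t ≡ w t
      comb-injective v w eq t = toℕ-injective (<p∧∣⇒≡ (toℕ<n (v t)) (toℕ<n (w t)) (p∣v-w t))
        where
        p∣v-w : ∀ t → p ∣ toℕ (v t) ℕ.+ q ℕ.* toℕ (w t)
        p∣v-w = indep _ (begin
          comb b (λ t → toℕ (v t) ℕ.+ q ℕ.* toℕ (w t))           ≈⟨ comb-+ b (toℕ ∘ v) (λ t → q ℕ.* toℕ (w t)) ⟩
          comb b (toℕ ∘ v) ∙ comb b (λ t → q ℕ.* toℕ (w t))      ≈⟨ ∙-cong eq (comb-* b q (toℕ ∘ w)) ⟩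
          p · comb b (toℕ ∘ w)                                   ≈⟨ exponent _ ⟩
          ε                                                      ∎)

      basis⇒iso : (∀ x → x ∈⟨ b ⟩) → IsoToZpm G q m
      basis⇒iso spans = ψ , ψ-cong , ψ-inj , ψ-surj , ψ-homo
        where
        ⟦_⟧ : (Fin m → Fin p) → Carrier
        ⟦ v ⟧ = comb b (toℕ ∘ v)

        -- The coefficients come from an arbitrary choice in `spans`. Each property of `ψ` is
        -- checked after applying `⟦_⟧`, whose injectivity makes the residues unique.
        ψ : Carrier → Fin m → Fin p
        ψ x = residue ∘ proj₁ (spans x)

        ⟦ψ⟧ : ∀ x → ⟦ ψ x ⟧ ≈ x
        ⟦ψ⟧ x = trans (comb-residue b _) (proj₂ (spans x))

        ψ-cong : ∀ x y → x ≈ y → ∀ t → ψ x t ≡ ψ y t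
        ψ-cong x y x≈y = comb-injective _ _ (trans (⟦ψ⟧ x) (trans x≈y (sym (⟦ψ⟧ y))))

        ψ-inj : ∀ x y → (∀ t → ψ x t ≡ ψ y t) → x ≈ y
        ψ-inj x y eq = trans (sym (⟦ψ⟧ x)) (trans (comb-≗ b (≡.cong toℕ ∘ eq)) (⟦ψ⟧ y))

        ψ-surj : ∀ v → ∃ λ x → ∀ t → ψ x t ≡ v t
        ψ-surj v = ⟦ v ⟧ , comb-injective _ v (⟦ψ⟧ ⟦ v ⟧)

        ψ-homo : ∀ x y t → ψ (x ∙ y) t ≡ (ψ x t +ₘ ψ y t)
        ψ-homo x y = comb-injective _ (λ t → ψ x t +ₘ ψ y t) (begin
          ⟦ ψ (x ∙ y) ⟧                                    ≈⟨ ⟦ψ⟧ (x ∙ y) ⟩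
          x ∙ y                                            ≈⟨ ∙-cong (⟦ψ⟧ x) (⟦ψ⟧ y) ⟨
          ⟦ ψ x ⟧ ∙ ⟦ ψ y ⟧                                ≈⟨ comb-+ b (toℕ ∘ ψ x) (toℕ ∘ ψ y) ⟨
          -- `_+ₘ_` unfolds to `residue` of the sum of natural numbers.
          comb b (λ t → toℕ (ψ x t) ℕ.+ toℕ (ψ y t))       ≈⟨ comb-residue b _ ⟨
          ⟦ (λ t → ψ x t +ₘ ψ y t) ⟧                       ∎)

  -- The enumeration of all of `G` serves as the spanning family from which a basis is selected.
  prime-exponent⇒elementaryAbelian : ∀ {n} → HasOrder G n → (∀ x → p · x ≈ ε) → IsElementaryAbelian G
  prime-exponent⇒elementaryAbelian ord exponent =
    let m , b , indep , spans = basis exponent _≈?_ enum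
    in q , pr , m , basis⇒iso exponent indep λ x →
         let c , eq = spans (index x) in c , trans eq (enum-index x)
    where open Enumeration G ord

theorem4p5 : ∀ {c₁ ℓ₁ c₂ ℓ₂} (G₁ : AbelianGroup c₁ ℓ₁) (G₂ : AbelianGroup c₂ ℓ₂) (n : ℕ) →
    HasOrder G₁ n → HasOrder G₂ (suc n) →
    (φ : AbelianGroup.Carrier G₁ → AbelianGroup.Carrier G₂) →
    IsCircularCostas G₁ G₂ φ →
    IsElementaryAbelian G₂
theorem4p5 G₁ G₂ n ord₁ ord₂ φ costas =
  let q , pr , exponent = costas⇒prime-exponent G₁ G₂ ord₁ ord₂ costas
  in PrimeExponent.prime-exponent⇒elementaryAbelian G₂ pr ord₂ exponent
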